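{- Let $\mathcal{H}$ be a family of graphs. There is a constant $C=C(\mathcal{H})$ such that $$\#\{v\in V(G):c(N(v))\ge 2\}\le C$$ for every connected $\mathcal{H}$-free graph $G$ if and only if $$\mathcal{H}\le \{K_n^*,\ P_n,\ K_{1,n}^*,\ K_{2,n},\ CK_n,\ T_n\}$$ for some positive integer $n$.
   Context: All graphs are finite, undirected and simple. For graphs $H_1,H_2$, write $H_1\le H_2$ if $H_1$ is (isomorphic to) an induced subgraph of $H_2$. A graph $G$ is $\mathcal{H}$-free if there is no $H\in\mathcal{H}$ with $H\le G$. For families of graphs $\mathcal{H}_1,\mathcal{H}_2$, write $\mathcal{H}_1\le\mathcal{H}_2$ if for every $H_2\in\mathcal{H}_2$ there is $H_1\in\mathcal{H}_1$ with $H_1\le H_2$. $N(v)$ is the set of vertices of $G$ adjacent to $v$, and for $S\subset V(G)$, $c(S)$ is the number of connected components of the induced subgraph $G[S]$. $K_n$ is the complete graph and $E_n$ the edgeless graph on $n$ vertices, $P_n$ the path on $n$ vertices, $K_{s,t}$ the complete bipartite graph. $G_1+G_2$ denotes the join of $G_1$ and $G_2$: the graph with vertex set $V(G_1)\sqcup V(G_2)$ whose edges are those of $G_1$, those of $G_2$, and all pairs $\{x,y\}$ with $x\in V(G_1)$, $y\in V(G_2)$. $K_{1,n}^*$ is obtained from the star $K_{1,n}$ by attaching one pendant vertex to each of its $n$ leaves. $K_n^*$ is obtained from $K_n$ by attaching one pendant vertex to every vertex of $K_n$. $CK_n$ is obtained from two disjoint copies of $K_n$ by adding a perfect matching between them.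 $T_n$ is obtained from the join $K_n+E_n$ by adding one new vertex adjacent to exactly the vertices of $E_n$. -}

module Defs where

open import Data.Empty using (⊥)
open import Data.Fin using (Fin; toℕ)
open import Data.Fin.Properties as Fin using (+↔⊎; inj⇒≟)
open import Data.List using (List; []; _∷_; map; filter; length; lookup; allFin; deduplicate)
open import Data.List.Membership.Propositional using (_∈_)
open import Data.List.Membership.Propositional.Properties using (∈-map⁺; ∈-allFin)
open import Data.List.Relation.Unary.Any using (here; there)
open import Data.Nat as ℕ using (ℕ; suc; _+_)
open import Data.Nat.Properties using (1+n≢n)
open import Data.Product using (_×_; _,_; ∃-syntax; Σ-syntax)
open import Data.Sum using (_⊎_; inj₁; inj₂; [_,_]′; swap)
open import Data.Sum.Function.Propositional using (_⊎-↔_)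
open import Data.Unit using (⊤; tt)
open import Function using (_∘_; id)
open import Function.Bundles using (_↔_; _⇔_; Inverse)
open import Function.Construct.Composition using (_↔-∘_)
open import Function.Construct.Identity using (↔-id)
open import Function.Construct.Symmetry using (↔-sym)
open import Function.Definitions using (Injective)
open import Function.Properties.Inverse using (Inverse⇒Injection)
open import Level using (Level; 0ℓ) renaming (suc to ℓsuc; _⊔_ to _⊔ℓ_)
open import Relation.Binary.Construct.Closure.ReflexiveTransitive using (Star; ε; _◅_; _◅◅_)
open import Relation.Binary.Core using (Rel; REL)
open import Relation.Binary.Definitions
  using (Symmetric; Irreflexive; Decidable; DecidableEquality)
open import Relation.Binary.PropositionalEquality using (_≡_; _≢_; refl; sym; subst)
open import Relation.Nullary using (yes; no; ¬_; ¬?; _×-dec_; _⊎-dec_)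
open import Relation.Nullary.Decidable using (map′)
open import Relation.Unary using (Pred) renaming (Decidable to Decidable₁)

module Reachability {A : Set} (_≟_ : DecidableEquality A)
                    {_∼_ : Rel A 0ℓ} (_∼?_ : Decidable _∼_) where

  -- Walks from u to v whose inner vertices lie in xs (Floyd–Warshall).
  Via : List A → Rel A 0ℓ
  Via []       u v = u ≡ v ⊎ u ∼ v
  Via (x ∷ xs) u v = Via xs u v ⊎ (Via xs u x × Via xs x v)

  via? : ∀ xs → Decidable (Via xs)
  via? []       u v = (u ≟ v) ⊎-dec (u ∼? v)
  via? (x ∷ xs) u v = via? xs u v ⊎-dec (via? xs u x ×-dec via? xs x v)

  via⇒star : ∀ xs {u v} → Via xs u v → Star _∼_ u v
  via⇒star []       (inj₁ refl)    = ε
  via⇒star []       (inj₂ e)       = e ◅ ε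
  via⇒star (x ∷ xs) (inj₁ p)       = via⇒star xs p
  via⇒star (x ∷ xs) (inj₂ (p , q)) = via⇒star xs p ◅◅ via⇒star xs q

  via-base : ∀ xs {u v} → u ≡ v ⊎ u ∼ v → Via xs u v
  via-base []       p = p
  via-base (x ∷ xs) p = inj₁ (via-base xs p)

  via-trans : ∀ xs {u w v} → w ∈ xs → Via xs u w → Via xs w v → Via xs u v
  via-trans (x ∷ xs) (here refl) p q = inj₂ ([ id , (λ (a , _) → a) ]′ p , [ id , (λ (_ , b) → b) ]′ q)
  via-trans (x ∷ xs) (there w∈) (inj₁ p)       (inj₁ q)       = inj₁ (via-trans xs w∈ p q)
  via-trans (x ∷ xs) (there w∈) (inj₁ p)       (inj₂ (q , r)) = inj₂ (via-trans xs w∈ p q , r)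
  via-trans (x ∷ xs) (there w∈) (inj₂ (p , q)) (inj₁ r)       = inj₂ (p , via-trans xs w∈ q r)
  via-trans (x ∷ xs) (there w∈) (inj₂ (p , _)) (inj₂ (_ , r)) = inj₂ (p , r)

  star⇒via : ∀ xs → (∀ x → x ∈ xs) → ∀ {u v} → Star _∼_ u v → Via xs u v
  star⇒via xs all ε       = via-base xs (inj₁ refl)
  star⇒via xs all (e ◅ p) = via-trans xs (all _) (via-base xs (inj₂ e)) (star⇒via xs all p)

  star? : ∀ xs → (∀ x → x ∈ xs) → Decidable (Star _∼_)
  star? xs all u v = map′ (via⇒star xs) (star⇒via xs all) (via? xs u v)

record Graph : Set₁ where
  infix 4 _∼_ _∼?_ _≟_
  field
    Vertex   : Set
    order    : ℕ
    finite   : Vertex ↔ Fin order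
    _∼_      : Rel Vertex 0ℓ
    _∼?_     : Decidable _∼_
    ∼-sym    : Symmetric _∼_
    ∼-irrefl : Irreflexive _≡_ _∼_

  open Inverse finite using (to; from; strictlyInverseʳ)

  vertices : List Vertex
  vertices = map from (allFin order)

  vertices-complete : ∀ v → v ∈ vertices
  vertices-complete v =
    subst (_∈ vertices) (strictlyInverseʳ v) (∈-map⁺ from (∈-allFin (to v)))

  _≟_ : DecidableEquality Vertex
  _≟_ = inj⇒≟ (Inverse⇒Injection finite)

  Linked : Rel Vertex 0ℓ
  Linked = Star _∼_

  linked? : Decidable Linked
  linked? = Reachability.star? _≟_ _∼?_ vertices vertices-complete

  # : {P : Pred Vertex 0ℓ} → Decidable₁ P → ℕ
  # P? = length (filter P? vertices)

  N : Vertex → Pred Vertex 0ℓ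
  N v u = v ∼ u

  N? : ∀ v → Decidable₁ (N v)
  N? v u = v ∼? u

open Graph using (Vertex)

-- The null graph counts as connected.
Connected : Graph → Set
Connected G = ∀ u v → Graph.Linked G u v

-- Deduplication up to linkedness keeps one vertex from each component.
components : Graph → ℕ
components G = length (deduplicate linked? vertices)
  where open Graph G

-- The induced subgraph G[S]; its vertices are the positions in the list of
-- members of S.
induced : (G : Graph) {S : Pred (Vertex G) 0ℓ} → Decidable₁ S → Graph
induced G S? = record
  { Vertex   = Fin (length members)
  ; order    = length members
  ; finite   = ↔-id _
  ; _∼_      = λ i j → lookup members i ∼ lookup members j
  ; _∼?_     = λ i j → lookup members i ∼? lookup members j
  ; ∼-sym    = ∼-sym
  ; ∼-irrefl = λ { refl → ∼-irrefl refl }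
  }
  where
  open Graph G hiding (Vertex)
  members : List (Vertex G)
  members = filter S? vertices

c : (G : Graph) {S : Pred (Vertex G) 0ℓ} → Decidable₁ S → ℕ
c G S? = components (induced G S?)

#disconnectedNeighbourhoods : Graph → ℕ
#disconnectedNeighbourhoods G = # (λ v → 2 ℕ.≤? c G (N? v))
  where open Graph G

infix 4 _≤ᴳ_ _≤ᶠ_

-- An isomorphism of H onto the subgraph of G induced by the image of f.
_≤ᴳ_ : Graph → Graph → Set
H ≤ᴳ G = Σ[ f ∈ (Vertex H → Vertex G) ]
           Injective _≡_ _≡_ f × (∀ u v → u H.∼ v ⇔ f u G.∼ f v)
  where
  module H = Graph H
  module G = Graph G

Family : (ℓ : Level) → Set (ℓsuc 0ℓ ⊔ℓ ℓsuc ℓ)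
Family ℓ = Pred Graph ℓ

Free : ∀ {ℓ} → Family ℓ → Graph → Set (ℓsuc 0ℓ ⊔ℓ ℓ)
Free 𝓗 G = ¬ (∃[ H ] 𝓗 H × H ≤ᴳ G)

_≤ᶠ_ : ∀ {ℓ₁ ℓ₂} → Family ℓ₁ → Family ℓ₂ → Set (ℓsuc 0ℓ ⊔ℓ ℓ₁ ⊔ℓ ℓ₂)
𝓗₁ ≤ᶠ 𝓗₂ = ∀ H₂ → 𝓗₂ H₂ → ∃[ H₁ ] 𝓗₁ H₁ × H₁ ≤ᴳ H₂

-- The disjoint union of G and H together with the cross edges given by B.
glue : (G H : Graph) {B : REL (Vertex G) (Vertex H) 0ℓ} → Decidable B → Graph
glue G H {B} B? = record
  { Vertex   = G.Vertex ⊎ H.Vertex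
  ; order    = G.order + H.order
  ; finite   = ↔-sym +↔⊎ ↔-∘ (G.finite ⊎-↔ H.finite)
  ; _∼_      = _≈_
  ; _∼?_     = ≈?
  ; ∼-sym    = λ {x} {y} → ≈-sym x y
  ; ∼-irrefl = λ { {inj₁ _} refl → G.∼-irrefl refl ; {inj₂ _} refl → H.∼-irrefl refl }
  }
  where
  module G = Graph G
  module H = Graph H

  _≈_ : Rel (G.Vertex ⊎ H.Vertex) 0ℓ
  inj₁ u ≈ inj₁ v = u G.∼ v
  inj₁ u ≈ inj₂ y = B u y
  inj₂ x ≈ inj₁ v = B v x
  inj₂ x ≈ inj₂ y = x H.∼ y

  ≈? : Decidable _≈_
  ≈? (inj₁ u) (inj₁ v) = u G.∼? v
  ≈? (inj₁ u) (inj₂ y) = B? u y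
  ≈? (inj₂ x) (inj₁ v) = B? v x
  ≈? (inj₂ x) (inj₂ y) = x H.∼? y

  ≈-sym : ∀ x y → x ≈ y → y ≈ x
  ≈-sym (inj₁ u) (inj₁ v) = G.∼-sym
  ≈-sym (inj₁ u) (inj₂ y) = id
  ≈-sym (inj₂ x) (inj₁ v) = id
  ≈-sym (inj₂ x) (inj₂ y) = H.∼-sym

K : ℕ → Graph
K n = record
  { Vertex   = Fin n
  ; order    = n
  ; finite   = ↔-id _
  ; _∼_      = _≢_
  ; _∼?_     = λ i j → ¬? (i Fin.≟ j)
  ; ∼-sym    = λ i≢j → i≢j ∘ sym
  ; ∼-irrefl = λ i≡j i≢j → i≢j i≡j
  }

E : ℕ → Graph
E n = record
  { Vertex   = Fin n
  ; order    = n
  ; finite   = ↔-id _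
  ; _∼_      = λ _ _ → ⊥
  ; _∼?_     = λ _ _ → no id
  ; ∼-sym    = id
  ; ∼-irrefl = λ _ → id
  }

P : ℕ → Graph
P n = record
  { Vertex   = Fin n
  ; order    = n
  ; finite   = ↔-id _
  ; _∼_      = λ i j → suc (toℕ i) ≡ toℕ j ⊎ suc (toℕ j) ≡ toℕ i
  ; _∼?_     = λ i j → (suc (toℕ i) ℕ.≟ toℕ j) ⊎-dec (suc (toℕ j) ℕ.≟ toℕ i)
  ; ∼-sym    = swap
  ; ∼-irrefl = λ { refl → [ 1+n≢n , 1+n≢n ]′ }
  }

infixl 6 _+ᴳ_

_+ᴳ_ : Graph → Graph → Graph
G +ᴳ H = glue G H {λ _ _ → ⊤} (λ _ _ → yes tt)

K⟨_,_⟩ : ℕ → ℕ → Graph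
K⟨ s , t ⟩ = E s +ᴳ E t

-- A new vertex i, adjacent to f i only, for each i : Fin k.
attachPendants : (G : Graph) {k : ℕ} → (Fin k → Vertex G) → Graph
attachPendants G {k} f = glue G (E k) (λ v i → v ≟ f i)
  where open Graph G

K* : ℕ → Graph
K* n = attachPendants (K n) {n} id

K₁* : ℕ → Graph
K₁* n = attachPendants K⟨ 1 , n ⟩ {n} inj₂

CK : ℕ → Graph
CK n = glue (K n) (K n) Fin._≟_

T : ℕ → Graph
T n = glue (K n +ᴳ E n) (E 1) {InE} inE?
  where
  InE : REL (Fin n ⊎ Fin n) (Fin 1) 0ℓ
  InE (inj₁ _) _ = ⊥
  InE (inj₂ _) _ = ⊤

  inE? : Decidable InE
  inE? (inj₁ _) _ = no id
  inE? (inj₂ _) _ = yes tt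

sixGraphs : ℕ → Family (ℓsuc 0ℓ)
sixGraphs n G = G ∈ K* n ∷ P n ∷ K₁* n ∷ K⟨ 2 , n ⟩ ∷ CK n ∷ T n ∷ []

{-# OPTIONS --safe #-}

-- For n = 3 + C, each of the six graphs other than T_n is connected and has more than C vertices
-- with a disconnected neighbourhood: an edge vu in no triangle splits N(v) as soon as deg v ≥ 2.
-- As T_n contains K_{2,n}, it needs no separate argument and plays no role in the converse.
--
-- Conversely, apply Ramsey's theorem to the vertices with a disconnected neighbourhood. Each such v
-- with a neighbour x has a neighbour w_v in a component of N(v) not containing x.
-- If many of the v form a clique, take x to be one of them: the w_v form a matching with the
-- remaining v, and Ramsey on the w_v gives K*_n or CK_n.
-- If many are independent, then many of those have a common neighbour x. This goes by induction on
-- the distance to a root, which is bounded as G is connected and P_n-free: after Ramsey, parents on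
-- paths to the root either are shared, or form an induced matching with their children. In the
-- latter case they form a clique, which gives K*_n, or they are independent, and a common neighbour
-- of many parents is adjacent to many of the children or else is the centre of a K*_{1,n}.
-- Finally w_v ≁ x for the v adjacent to x, and Ramsey gives K_{2,n} (one w adjacent to many v),
-- K*_n (the w_v form a clique) or K*_{1,n}.
module Submission where

open import Defs
open import Axiom.DoubleNegationElimination using (em⇒dne)
open import Axiom.ExcludedMiddle using (ExcludedMiddle)
open import Data.Empty using (⊥; ⊥-elim)
open import Data.Fin using (Fin; zero; suc; toℕ; inject₁; punchIn)
open import Data.Fin.Induction using (<-weakInduction)
import Data.Fin.Properties as Fin
open import Data.List using (List; []; _∷_; map; filter; length; lookup; deduplicate)
open import Data.List.Membership.Propositional using (_∈_; find; lose)
open import Data.List.Membership.Propositional.Properties using (∈-filter⁺; ∈-filter⁻; ∈-lookup)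
open import Data.List.Properties using (length-map; filter-none)
open import Data.List.Relation.Binary.Sublist.Propositional using (_⊆_; _∷_; _∷ʳ_; ⊆-refl; ⊆-trans; minimum)
open import Data.List.Relation.Binary.Sublist.Propositional.Properties using (All-resp-⊆; map⁺)
open import Data.List.Relation.Unary.All as All using (All; []; _∷_)
import Data.List.Relation.Unary.All.Properties as All
open import Data.List.Relation.Unary.AllPairs as AllPairs using (AllPairs; []; _∷_)
import Data.List.Relation.Unary.AllPairs.Properties as AllPairs
open import Data.List.Relation.Unary.Any as Any using (Any; here; there)
import Data.List.Relation.Unary.Any.Properties as Any
open import Data.List.Relation.Unary.Unique.Propositional using (Unique)
import Data.List.Relation.Unary.Unique.Propositional.Properties as Unique
open import Data.Nat using (ℕ; zero; suc; _+_; _∸_; _≤_; _<_; z≤n; s≤s; _≤?_)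
import Data.Nat.Properties as ℕ
open import Data.Product using (_×_; _,_; proj₁; proj₂; ∃-syntax; Σ-syntax)
open import Data.Sum using (_⊎_; inj₁; inj₂; [_,_]; [_,_]′; swap)
open import Function using (_∘_; id; case_of_)
open import Function.Bundles using (_⇔_; mk⇔; Equivalence; Inverse)
open import Function.Definitions using (Injective)
open import Level using (Level; 0ℓ; _⊔_) renaming (suc to ℓsuc)
open import Relation.Binary.Construct.Closure.ReflexiveTransitive using (ε; _◅_; _◅◅_; reverse)
open import Relation.Binary.Core using (Rel)
open import Relation.Binary.Definitions using (Decidable; Symmetric; Transitive; tri<; tri≈; tri>)
open import Relation.Binary.PropositionalEquality using (_≡_; _≢_; refl; sym; trans; cong; subst)
open import Relation.Nullary using (¬_; yes; no; ¬?; _×-dec_; _⊎-dec_; contradiction)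
open import Relation.Nullary.Decidable using (map′; toSum; decidable-stable)
open import Relation.Unary using (Pred; _∪_) renaming (Decidable to Decidable₁)

private variable
  A : Set

-- Ramsey's theorem for lists

-- The length is exact, so that matching on `refl` turns a count into the length of the list found.
HasSublist : ℕ → Pred (List A) 0ℓ → Pred (List A) 0ℓ
HasSublist n Q xs = ∃[ ys ] ys ⊆ xs × length ys ≡ n × Q ys

AllPairs-resp-⊆ : {R : Rel A 0ℓ} {xs ys : List A} → ys ⊆ xs → AllPairs R xs → AllPairs R ys
AllPairs-resp-⊆ {ys = []}    _           _          = []
AllPairs-resp-⊆ (_    ∷ʳ ys⊆xs) (_  ∷ rs) = AllPairs-resp-⊆ ys⊆xs rs
AllPairs-resp-⊆ (refl ∷  ys⊆xs) (rx ∷ rs) = All-resp-⊆ ys⊆xs rx ∷ AllPairs-resp-⊆ ys⊆xs rs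

AllPairs-lookup : {R : Rel A 0ℓ} → Symmetric R → {xs : List A} → AllPairs R xs →
                  ∀ {i j} → i ≢ j → R (lookup xs i) (lookup xs j)
AllPairs-lookup R-sym (rx ∷ rs) {zero}  {zero}  i≢j = contradiction refl i≢j
AllPairs-lookup R-sym (rx ∷ rs) {zero}  {suc j} i≢j = All.lookup rx (∈-lookup j)
AllPairs-lookup R-sym (rx ∷ rs) {suc i} {zero}  i≢j = R-sym (All.lookup rx (∈-lookup i))
AllPairs-lookup R-sym (rx ∷ rs) {suc i} {suc j} i≢j = AllPairs-lookup R-sym rs (i≢j ∘ cong suc)

All-lookup : {P : Pred A 0ℓ} {xs : List A} → All P xs → ∀ i → P (lookup xs i)
All-lookup ps i = All.lookup ps (∈-lookup i)

-- Turns witnesses scattered through an `All` into data carried by the entries, so that a chosen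
-- witness becomes a function of the entry.
attach : {P : Pred A 0ℓ} {xs : List A} → All P xs → ∃[ zs ] map (proj₁ {B = P}) zs ≡ xs
attach []       = [] , refl
attach (p ∷ ps) = let zs , eq = attach ps in (_ , p) ∷ zs , cong (_ ∷_) eq

pigeonhole : {P Q : Pred A 0ℓ} (a b : ℕ) {xs : List A} → a + b ≤ length xs → All (P ∪ Q) xs →
             HasSublist a (All P) xs ⊎ HasSublist b (All Q) xs
pigeonhole zero    b       _ _ = inj₁ ([] , minimum _ , refl , [])
pigeonhole (suc a) zero    _ _ = inj₂ ([] , minimum _ , refl , [])
pigeonhole (suc a) (suc b) {x ∷ xs} (s≤s le) (inj₁ p ∷ pqs) with pigeonhole a (suc b) le pqs
... | inj₁ (ys , ys⊆xs , refl , ps) = inj₁ (x ∷ ys , refl ∷ ys⊆xs , refl , p ∷ ps)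
... | inj₂ (ys , ys⊆xs , eq   , qs) = inj₂ (ys , x ∷ʳ ys⊆xs , eq , qs)
pigeonhole (suc a) (suc b) {x ∷ xs} (s≤s le) (inj₂ q ∷ pqs)
  with pigeonhole (suc a) b (subst (_≤ length xs) (ℕ.+-suc a b) le) pqs
... | inj₁ (ys , ys⊆xs , eq   , ps) = inj₁ (ys , x ∷ʳ ys⊆xs , eq , ps)
... | inj₂ (ys , ys⊆xs , refl , qs) = inj₂ (x ∷ ys , refl ∷ ys⊆xs , refl , q ∷ qs)

-- The Erdős-Szekeres recurrence, with one more for the head of the list; `pigeonhole` splits the
-- rest.
ramseyBound : ℕ → ℕ → ℕ
ramseyBound zero    b       = 0
ramseyBound (suc a) zero    = 0
ramseyBound (suc a) (suc b) = suc (ramseyBound a (suc b) + ramseyBound (suc a) b)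

-- The head is compared with all later entries and a large enough colour class is treated
-- recursively. Only pairs in list order are coloured, so asymmetric relations such as `g a ∼ f b`
-- are allowed.
ramsey : {R : Rel A 0ℓ} → Decidable R → (a b : ℕ) {xs : List A} → ramseyBound a b ≤ length xs →
         HasSublist a (AllPairs R) xs ⊎ HasSublist b (AllPairs (λ x y → ¬ R x y)) xs
ramsey R? zero    b       _ = inj₁ ([] , minimum _ , refl , [])
ramsey R? (suc a) zero    _ = inj₂ ([] , minimum _ , refl , [])
ramsey R? (suc a) (suc b) {x ∷ xs} (s≤s le)
  with pigeonhole (ramseyBound a (suc b)) (ramseyBound (suc a) b) le
                  (All.universal (λ y → toSum (R? x y)) xs)
... | inj₁ (ys , ys⊆xs , eq , rs) with ramsey R? a (suc b) (ℕ.≤-reflexive (sym eq))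
...   | inj₁ (zs , zs⊆ys , refl , h) =
        inj₁ (x ∷ zs , refl ∷ ⊆-trans zs⊆ys ys⊆xs , refl , All-resp-⊆ zs⊆ys rs ∷ h)
...   | inj₂ (zs , zs⊆ys , eq′  , h) = inj₂ (zs , x ∷ʳ ⊆-trans zs⊆ys ys⊆xs , eq′ , h)
ramsey R? (suc a) (suc b) {x ∷ xs} (s≤s le)
    | inj₂ (ys , ys⊆xs , eq , rs) with ramsey R? (suc a) b (ℕ.≤-reflexive (sym eq))
...   | inj₁ (zs , zs⊆ys , eq′  , h) = inj₁ (zs , x ∷ʳ ⊆-trans zs⊆ys ys⊆xs , eq′ , h)
...   | inj₂ (zs , zs⊆ys , refl , h) =
        inj₂ (x ∷ zs , refl ∷ ⊆-trans zs⊆ys ys⊆xs , refl , All-resp-⊆ zs⊆ys rs ∷ h)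

-- The counterpart of taking the head: with pairs ordered by the list, the last entry is the one
-- that all others relate to.
splitLast : {R : Rel A 0ℓ} (n : ℕ) {xs : List A} → length xs ≡ suc n → AllPairs R xs →
            ∃[ y ] y ∈ xs × HasSublist n (All (λ x → R x y)) xs
splitLast zero    {x ∷ []}     refl _ = x , here refl , [] , minimum _ , refl , []
splitLast (suc n) {x ∷ y ∷ xs} eq (rx ∷ rs) with splitLast n (ℕ.suc-injective eq) rs
... | z , z∈ , ys , ys⊆ , refl , h =
  z , there z∈ , x ∷ ys , refl ∷ ys⊆ , refl , All.lookup rx z∈ ∷ h

-- Components

module _ {R : Rel A 0ℓ} (R? : Decidable R) where

  deduplicate-total : (∀ x y → R x y) → ∀ xs → length (deduplicate R? xs) ≤ 1
  deduplicate-total r []       = z≤n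
  deduplicate-total r (x ∷ xs)
    rewrite filter-none (¬? ∘ R? x) (All.universal (λ y ¬r → ¬r (r x y)) (deduplicate R? xs))
    = ℕ.≤-refl

  -- Each of x and y is related to some survivor; a common survivor would relate x to y by
  -- transitivity.
  deduplicate-unrelated : Symmetric R → Transitive R → ∀ {x y xs} → x ∈ xs → y ∈ xs → ¬ R x y →
                          R x x → R y y → 2 ≤ length (deduplicate R? xs)
  deduplicate-unrelated R-sym R-trans {x} {y} {xs} x∈ y∈ ¬xy xx yy =
    two (represented x∈ xx) (represented y∈ yy)
    where
    represented : ∀ {z} → z ∈ xs → R z z → Any (R z) (deduplicate R? xs)
    represented {z} z∈ zz = Any.deduplicate⁺ R? (λ ba za → R-trans za (R-sym ba)) (lose z∈ zz)

    two : ∀ {ys} → Any (R x) ys → Any (R y) ys → 2 ≤ length ys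
    two (here xz)          (here yz)  = contradiction (R-trans xz (R-sym yz)) ¬xy
    two {_ ∷ _ ∷ _} (here _)  (there _) = s≤s (s≤s z≤n)
    two {_ ∷ _ ∷ _} (there _) _         = s≤s (s≤s z≤n)

≤ᴳ-trans : ∀ {F G H} → F ≤ᴳ G → G ≤ᴳ H → F ≤ᴳ H
≤ᴳ-trans (f , f-inj , f-adj) (g , g-inj , g-adj) =
  g ∘ f , f-inj ∘ g-inj ,
  λ u v → mk⇔ (to (g-adj _ _) ∘ to (f-adj u v)) (from (f-adj u v) ∘ from (g-adj _ _))
  where open Equivalence

-- Explicit bounds for the Ramsey arguments

-- One layer for each use of Ramsey in `sparsify`; `suc m` allows for the entry that becomes the
-- common neighbour.
matchingBound : ℕ → ℕ → ℕ → ℕ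
matchingBound m n l = ramseyBound (suc m) (ramseyBound (suc m) (ramseyBound n l))

-- Radius 0 holds only the root, so two distinct vertices are too many. In the recursive call `m`
-- allows for children adjacent to the vertex found, `n` for the legs of a `K₁*`, and 2 for children
-- equal to that vertex, of which there is at most one.
neighbourBound : ℕ → ℕ → ℕ → ℕ
neighbourBound n zero    m = 2
neighbourBound n (suc k) m =
  neighbourBound n k m + matchingBound m n (neighbourBound n k (m + (n + 2)))

-- The clique has one extra vertex to serve as a common neighbour; the radius is `n` because `P n`
-- is excluded.
disconnectedBound : ℕ → ℕ
disconnectedBound n =
  ramseyBound (suc (ramseyBound n n)) (neighbourBound n n (matchingBound n n n))

-- Vertices with a disconnected neighbourhood

module _ (G : Graph) where
  open Graph G
  open Inverse finite using () renaming (to to index; from to vertex; strictlyInverseˡ to index-vertex)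

  Disconnected : Pred Vertex 0ℓ
  Disconnected v = 2 ≤ c G (N? v)

  vertices-unique : Unique vertices
  vertices-unique = Unique.map⁺ vertex-injective (Unique.allFin⁺ order)
    where
    vertex-injective : ∀ {i j} → vertex i ≡ vertex j → i ≡ j
    vertex-injective {i} {j} eq = trans (sym (index-vertex i)) (trans (cong index eq) (index-vertex j))

  module _ (v : Vertex) where
    private
      module I = Graph (induced G (N? v))
      neighbours = filter (N? v) vertices

      position : ∀ {u} → v ∼ u → ∃[ i ] lookup neighbours i ≡ u
      position v∼u = let u∈ = ∈-filter⁺ (N? v) (vertices-complete _) v∼u in
        Any.index u∈ , sym (Any.lookup-index u∈)

      neighbour : ∀ i → v ∼ lookup neighbours i
      neighbour i = proj₂ (∈-filter⁻ (N? v) {xs = vertices} (∈-lookup i))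

      I-sym : Symmetric I.Linked
      I-sym = reverse (λ {i} {j} → I.∼-sym {i} {j})

    -- w lies in a component of N(v) other than that of x.
    unlinked-neighbour : Disconnected v → ∀ {x} → v ∼ x →
      ∃[ w ] v ∼ w × x ≢ w × ¬ x ∼ w × (∀ {u} → v ∼ u → x ∼ u → ¬ u ∼ w)
    unlinked-neighbour dis {x} v∼x with position v∼x
    ... | i , refl with Fin.¬∀⟶∃¬ _ (I.Linked i) (I.linked? i) ¬all
      where
      ¬all : ¬ (∀ j → I.Linked i j)
      ¬all all = ℕ.<⇒≱ dis (deduplicate-total I.linked? (λ j k → I-sym (all j) ◅◅ all k) I.vertices)
    ... | j , ¬ij =
      lookup neighbours j , neighbour j ,
      AllPairs-lookup (λ ≢ → ≢ ∘ sym) (Unique.filter⁺ (N? v) vertices-unique)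
        (λ { refl → ¬ij ε }) ,
      (λ ij → ¬ij (ij ◅ ε)) ,
      λ v∼u iu uj → case position v∼u of λ { (k , refl) → ¬ij (iu ◅ uj ◅ ε) }

    -- `u` is isolated in N(v): a walk from `u` to `w` inside N(v) would start with a step to a
    -- common neighbour of `u` and `v`.
    triangle-free-edge : ∀ {u w} → v ∼ u → v ∼ w → u ≢ w → (∀ {b} → v ∼ b → ¬ u ∼ b) →
                         Disconnected v
    triangle-free-edge v∼u v∼w u≢w isolated with position v∼u | position v∼w
    ... | i , refl | j , refl =
      deduplicate-unrelated I.linked? I-sym _◅◅_ (I.vertices-complete i) (I.vertices-complete j)
        (λ { ε → u≢w refl ; (_◅_ {j = k} ik _) → isolated (neighbour k) ik }) ε ε

  disconnected? : Decidable₁ Disconnected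
  disconnected? v = 2 ≤? c G (N? v)

  #disconnected-≥ : {n : ℕ} (f : Fin n → Vertex) → Injective _≡_ _≡_ f →
                    (∀ i → Disconnected (f i)) → n ≤ #disconnectedNeighbourhoods G
  #disconnected-≥ f f-inj dis = Fin.injective⇒≤ {f = Any.index ∘ f∈}
    (λ {i} {j} eq → f-inj (trans (Any.lookup-index (f∈ i))
      (trans (cong (lookup (filter disconnected? vertices)) eq) (sym (Any.lookup-index (f∈ j))))))
    where
    f∈ : ∀ i → f i ∈ filter disconnected? vertices
    f∈ i = ∈-filter⁺ disconnected? (vertices-complete (f i)) (dis i)

  -- Embeddings of the forbidden graphs

  Clique Nonadjacent : ∀ {n} → (Fin n → Vertex) → Set
  Clique f      = ∀ {i j} → i ≢ j → f i ∼ f j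
  Nonadjacent f = ∀ i j → ¬ f i ∼ f j

  -- `Matching` is literally the cross-edge condition of the gluings `K*` and `CK`; it says nothing
  -- about edges within `f` or within `g`.
  Matching Disjoint : ∀ {n} → (Fin n → Vertex) → (Fin n → Vertex) → Set
  Matching f g = ∀ i j → i ≡ j ⇔ f i ∼ g j
  Disjoint f g = ∀ i j → f i ≢ g j

  Matching-swap : ∀ {n} {f g : Fin n → Vertex} → Matching f g → Matching g f
  Matching-swap m i j = mk⇔ (∼-sym ∘ to (m j i) ∘ sym) (sym ∘ from (m j i) ∘ ∼-sym)
    where open Equivalence

  Matching-injective : ∀ {n} {f g : Fin n → Vertex} → Matching f g → Injective _≡_ _≡_ f
  Matching-injective {g = g} m {i} {j} eq = from (m i j) (subst (_∼ g j) (sym eq) (to (m j j) refl))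
    where open Equivalence

  Matching-disjoint : ∀ {n} {f g : Fin n → Vertex} → Matching f g → Nonadjacent f → Disjoint f g
  Matching-disjoint {f = f} m non i j eq = non j i (subst (f j ∼_) (sym eq) (to (m j j) refl))
    where open Equivalence

  separated : ∀ {n} {f g : Fin n → Vertex} {x} → (∀ i → x ∼ f i) → (∀ i → ¬ x ∼ g i) → Disjoint f g
  separated {x = x} x∼f x≁g i j eq = x≁g j (subst (x ∼_) eq (x∼f i))

  -- The forbidden graphs other than `P n` are iterated gluings, so their embeddings can be
  -- assembled from those of cliques and edgeless graphs.
  glue-≤ᴳ : ∀ {H₁ H₂ B} {B? : Decidable B} ((f , _) : H₁ ≤ᴳ G) ((g , _) : H₂ ≤ᴳ G) →
            (∀ u y → f u ≢ g y) → (∀ u y → B u y ⇔ f u ∼ g y) → glue H₁ H₂ {B} B? ≤ᴳ G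
  glue-≤ᴳ {H₁} {H₂} {B} {B?} (f , f-inj , f-adj) (g , g-inj , g-adj) f≢g cross =
    [ f , g ]′ , inj , adj
    where
    open Equivalence
    inj : Injective _≡_ _≡_ [ f , g ]′
    inj {inj₁ _} {inj₁ _} eq = cong inj₁ (f-inj eq)
    inj {inj₁ _} {inj₂ _} eq = contradiction eq (f≢g _ _)
    inj {inj₂ _} {inj₁ _} eq = contradiction (sym eq) (f≢g _ _)
    inj {inj₂ _} {inj₂ _} eq = cong inj₂ (g-inj eq)

    adj : ∀ u v → Graph._∼_ (glue H₁ H₂ {B} B?) u v ⇔ [ f , g ]′ u ∼ [ f , g ]′ v
    adj (inj₁ u) (inj₁ v) = f-adj u v
    adj (inj₁ u) (inj₂ y) = cross u y
    adj (inj₂ x) (inj₁ v) = mk⇔ (∼-sym ∘ to (cross v x)) (from (cross v x) ∘ ∼-sym)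
    adj (inj₂ x) (inj₂ y) = g-adj x y

  K-≤ᴳ : ∀ {n} {f : Fin n → Vertex} → Clique f → K n ≤ᴳ G
  K-≤ᴳ {f = f} clique = f , inj , λ i j → mk⇔ clique λ { e refl → ∼-irrefl refl e }
    where
    inj : Injective _≡_ _≡_ f
    inj {i} {j} eq = decidable-stable (i Fin.≟ j) (λ i≢j → ∼-irrefl eq (clique i≢j))

  E-≤ᴳ : ∀ {n} {f : Fin n → Vertex} → Injective _≡_ _≡_ f → Nonadjacent f → E n ≤ᴳ G
  E-≤ᴳ {f = f} inj non = f , inj , λ i j → mk⇔ ⊥-elim (non i j)

  E₁-≤ᴳ : Vertex → E 1 ≤ᴳ G
  E₁-≤ᴳ x = E-≤ᴳ {f = λ _ → x} (λ { {zero} {zero} _ → refl }) (λ _ _ → ∼-irrefl refl)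

  K*-≤ᴳ : ∀ {n} {f g : Fin n → Vertex} → Clique f → Nonadjacent g → Matching f g → Disjoint f g →
          K* n ≤ᴳ G
  K*-≤ᴳ clique non m disj =
    glue-≤ᴳ (K-≤ᴳ clique) (E-≤ᴳ (Matching-injective (Matching-swap m)) non) disj m

  CK-≤ᴳ : ∀ {n} {f g : Fin n → Vertex} → Clique f → Clique g → Matching f g → Disjoint f g →
          CK n ≤ᴳ G
  CK-≤ᴳ cliqueᶠ cliqueᵍ m disj = glue-≤ᴳ (K-≤ᴳ cliqueᶠ) (K-≤ᴳ cliqueᵍ) disj m

  K₁*-≤ᴳ : ∀ {n} {f g : Fin n → Vertex} {x} → Nonadjacent f → Nonadjacent g → Matching f g →
           (∀ i → x ∼ f i) → (∀ i → ¬ x ∼ g i) → (∀ i → x ≢ g i) → K₁* n ≤ᴳ G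
  K₁*-≤ᴳ {n} {f} {g} {x} nonᶠ nonᵍ m x∼f x≁g x≢g =
    glue-≤ᴳ
      (glue-≤ᴳ (E₁-≤ᴳ x) (E-≤ᴳ (Matching-injective m) nonᶠ) (λ _ i eq → ∼-irrefl eq (x∼f i))
               (λ _ i → mk⇔ (λ _ → x∼f i) _))
      (E-≤ᴳ (Matching-injective (Matching-swap m)) nonᵍ)
      (λ { (inj₁ _) j → x≢g j ; (inj₂ i) j → separated x∼f x≁g i j })
      (λ { (inj₁ _) j → mk⇔ (λ ()) (⊥-elim ∘ x≁g j)
         ; (inj₂ i) j → mk⇔ (λ { refl → to (m i i) refl }) (cong inj₂ ∘ from (m i j)) })
    where open Equivalence

  K₂-≤ᴳ : ∀ {n} {f : Fin n → Vertex} {x y} → Injective _≡_ _≡_ f → Nonadjacent f →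
          x ≢ y → ¬ x ∼ y → (∀ i → x ∼ f i) → (∀ i → y ∼ f i) → K⟨ 2 , n ⟩ ≤ᴳ G
  K₂-≤ᴳ {n} {f} {x} {y} inj non x≢y x≁y x∼f y∼f =
    glue-≤ᴳ (E-≤ᴳ {f = ends} ends-inj ends-non) (E-≤ᴳ inj non)
            (λ k i eq → ∼-irrefl eq (ends∼f k i)) (λ k i → mk⇔ (λ _ → ends∼f k i) _)
    where
    ends : Fin 2 → Vertex
    ends zero       = x
    ends (suc zero) = y

    ends-inj : Injective _≡_ _≡_ ends
    ends-inj {zero}     {zero}     _  = refl
    ends-inj {zero}     {suc zero} eq = contradiction eq x≢y
    ends-inj {suc zero} {zero}     eq = contradiction (sym eq) x≢y
    ends-inj {suc zero} {suc zero} _  = refl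

    ends-non : Nonadjacent ends
    ends-non zero       zero       = ∼-irrefl refl
    ends-non zero       (suc zero) = x≁y
    ends-non (suc zero) zero       = x≁y ∘ ∼-sym
    ends-non (suc zero) (suc zero) = ∼-irrefl refl

    ends∼f : ∀ k i → ends k ∼ f i
    ends∼f zero       = x∼f
    ends∼f (suc zero) = y∼f

  -- Bounded radius

  module _ (r : Vertex) where

    -- The second alternative keeps a parent in the smaller ball, which the induction in
    -- `common-neighbour` extracts.
    Within : ℕ → Pred Vertex 0ℓ
    Within zero    v = r ≡ v
    Within (suc k) v = Within k v ⊎ ∃[ p ] Within k p × p ∼ v

    within? : ∀ k → Decidable₁ (Within k)
    within? zero    v = r ≟ v
    within? (suc k) v = within? k v ⊎-dec
      map′ (λ any → let p , _ , h = find any in p , h) (λ (p , h) → lose (vertices-complete p) h)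
           (Any.any? (λ p → within? k p ×-dec (p ∼? v)) vertices)

    within-mono : ∀ {j k v} → j ≤ k → Within j v → Within k v
    within-mono {k = zero}  z≤n w = w
    within-mono {j} {suc k} le  w with ℕ.m≤n⇒m<n∨m≡n le
    ... | inj₁ (s≤s j≤k) = inj₁ (within-mono j≤k w)
    ... | inj₂ refl      = w

    linked⇒within : ∀ {p v k} → Within k p → Linked p v → ∃[ j ] Within j v
    linked⇒within w ε        = _ , w
    linked⇒within {k = k} w (e ◅ es) = linked⇒within {k = suc k} (inj₂ (_ , w , e)) es

    AtDistance : ℕ → Pred Vertex 0ℓ
    AtDistance d v = Within d v × (∀ {j} → j < d → ¬ Within j v)

    distance : ∀ k {v} → Within k v → ∃[ d ] AtDistance d v
    distance zero    w = zero , w , λ ()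
    distance (suc k) {v} w with within? k v
    ... | yes w′ = distance k w′
    ... | no ¬w  = suc k , w , λ { (s≤s j≤k) w′ → ¬w (within-mono j≤k w′) }

    distance-lipschitz : ∀ {a b u v} → AtDistance a u → AtDistance b v → u ∼ v → b ≤ suc a
    distance-lipschitz (w , _) (_ , min) e = ℕ.≮⇒≥ λ sa<b → min sa<b (inj₂ (_ , w , e))

    distance-unique : ∀ {a b v} → AtDistance a v → AtDistance b v → a ≤ b
    distance-unique (_ , min) (w , _) = ℕ.≮⇒≥ λ b<a → min b<a w

    -- h runs backwards from v to r, so that h i is at distance d - i from r.
    geodesic : ∀ d {v} → AtDistance d v → Σ[ h ∈ (ℕ → Vertex) ]
      h 0 ≡ v × (∀ i j → i + j ≡ d → AtDistance j (h i)) × (∀ i → i < d → h (suc i) ∼ h i)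
    geodesic zero    {v} (w , min) = (λ _ → v) , refl , (λ { zero zero refl → w , min }) , λ _ ()
    geodesic (suc d) {v} (inj₁ w , min) = contradiction w (min ℕ.≤-refl)
    geodesic (suc d) {v} (w@(inj₂ (p , wp , e)) , min)
      with geodesic d (wp , λ {j} j<d wj → min (s≤s j<d) (inj₂ (p , wj , e)))
    ... | h , refl , level , adj = h⁺ , refl , level⁺ , adj⁺
      where
      h⁺ : ℕ → Vertex
      h⁺ zero    = v
      h⁺ (suc i) = h i

      level⁺ : ∀ i j → i + j ≡ suc d → AtDistance j (h⁺ i)
      level⁺ zero    j refl = w , min
      level⁺ (suc i) j eq   = level i j (ℕ.suc-injective eq)

      adj⁺ : ∀ i → i < suc d → h⁺ (suc i) ∼ h⁺ i
      adj⁺ zero    _         = e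
      adj⁺ (suc i) (s≤s i<d) = adj i i<d

    -- Levels along a geodesic are pairwise distinct and an edge changes the level by at most one,
    -- so only consecutive vertices are adjacent. A geodesic of length d has d + 1 vertices.
    geodesic-induced : ∀ {n d v} → n ≤ suc d → AtDistance d v → P n ≤ᴳ G
    geodesic-induced {n} {d} n≤ dv with geodesic d dv
    ... | h , _ , level , adj = h ∘ toℕ , inj , λ i j → mk⇔ (to i j) (from i j)
      where
      depth : ∀ (i : Fin n) → ∃[ a ] toℕ i + a ≡ d
      depth i = d ∸ toℕ i , ℕ.m+[n∸m]≡n (ℕ.≤-pred (ℕ.≤-trans (Fin.toℕ<n i) n≤))

      level′ : ∀ i → AtDistance (proj₁ (depth i)) (h (toℕ i))
      level′ i = level (toℕ i) _ (proj₂ (depth i))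

      close : ∀ i j → proj₁ (depth j) ≤ suc (proj₁ (depth i)) → toℕ i ≤ suc (toℕ j)
      close i j le = ℕ.+-cancelʳ-≤ (proj₁ (depth i)) _ _ (begin
        toℕ i + proj₁ (depth i)           ≡⟨ proj₂ (depth i) ⟩
        d                                 ≡⟨ proj₂ (depth j) ⟨
        toℕ j + proj₁ (depth j)           ≤⟨ ℕ.+-monoʳ-≤ (toℕ j) le ⟩
        toℕ j + suc (proj₁ (depth i))     ≡⟨ ℕ.+-suc (toℕ j) _ ⟩
        suc (toℕ j) + proj₁ (depth i)     ∎)
        where open ℕ.≤-Reasoning

      depth-mono : ∀ i j → proj₁ (depth i) ≤ proj₁ (depth j) → toℕ j ≤ toℕ i
      depth-mono i j le = ℕ.+-cancelʳ-≤ (proj₁ (depth j)) _ _ (begin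
        toℕ j + proj₁ (depth j)           ≡⟨ proj₂ (depth j) ⟩
        d                                 ≡⟨ proj₂ (depth i) ⟨
        toℕ i + proj₁ (depth i)           ≤⟨ ℕ.+-monoʳ-≤ (toℕ i) le ⟩
        toℕ i + proj₁ (depth j)           ∎)
        where open ℕ.≤-Reasoning

      inj : Injective _≡_ _≡_ (h ∘ toℕ)
      inj {i} {j} eq = Fin.toℕ-injective (ℕ.≤-antisym
        (depth-mono j i (distance-unique (level′ j) (subst (AtDistance _) eq (level′ i))))
        (depth-mono i j (distance-unique (level′ i) (subst (AtDistance _) (sym eq) (level′ j)))))

      to : ∀ i j → Graph._∼_ (P n) i j → h (toℕ i) ∼ h (toℕ j)
      to i j (inj₁ eq) = ∼-sym (subst (λ k → h k ∼ h (toℕ i)) eq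
        (adj (toℕ i) (subst (_≤ d) (sym eq) (ℕ.≤-pred (ℕ.≤-trans (Fin.toℕ<n j) n≤)))))
      to i j (inj₂ eq) = subst (λ k → h k ∼ h (toℕ j)) eq
        (adj (toℕ j) (subst (_≤ d) (sym eq) (ℕ.≤-pred (ℕ.≤-trans (Fin.toℕ<n i) n≤))))

      from : ∀ i j → h (toℕ i) ∼ h (toℕ j) → Graph._∼_ (P n) i j
      from i j e with ℕ.<-cmp (toℕ i) (toℕ j)
        | close j i (distance-lipschitz (level′ j) (level′ i) (∼-sym e))
        | close i j (distance-lipschitz (level′ i) (level′ j) e)
      ... | tri< i<j _ _ | j≤ | _  = inj₁ (ℕ.≤-antisym i<j j≤)
      ... | tri≈ _ eq _  | _  | _  = contradiction e (∼-irrefl (cong h eq))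
      ... | tri> _ _ j<i | _  | i≤ = inj₂ (ℕ.≤-antisym j<i i≤)

    -- Distance n - 1 or more would yield an induced `P n` along a geodesic.
    P-free⇒within : Connected G → ∀ {n} → ¬ P n ≤ᴳ G → ∀ v → Within n v
    P-free⇒within conn {n} P-free v with linked⇒within {k = 0} refl (conn r v)
    ... | k , w with distance k w
    ... | d , dv with n ≤? suc d
    ...   | yes n≤ = contradiction (geodesic-induced n≤ dv) P-free
    ...   | no  n≰ = within-mono (ℕ.≤-trans (ℕ.m≤n+m d 2) (ℕ.≰⇒> n≰)) (proj₁ dv)

  -- Ramsey arguments

  module _ (f g : A → Vertex) where

    -- `AllPairs` sees each pair once, so both cross non-edges are recorded; edges within `f` or
    -- within `g` are left open.
    InducedMatching : Pred (List A) 0ℓ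
    InducedMatching xs = All (λ a → f a ∼ g a) xs ×
                         AllPairs (λ a b → ¬ f a ∼ g b × ¬ g a ∼ f b) xs

    InducedMatching-resp-⊆ : ∀ {xs ys} → ys ⊆ xs → InducedMatching xs → InducedMatching ys
    InducedMatching-resp-⊆ ys⊆ (e , ne) = All-resp-⊆ ys⊆ e , AllPairs-resp-⊆ ys⊆ ne

    InducedMatching⇒Matching : ∀ {xs} → InducedMatching xs →
                               Matching (f ∘ lookup xs) (g ∘ lookup xs)
    InducedMatching⇒Matching {xs} (e , ne) i j = mk⇔
      (λ { refl → All-lookup e i })
      (λ fg → decidable-stable (i Fin.≟ j) λ i≢j →
        proj₁ (AllPairs-lookup (λ (p , q) → q ∘ ∼-sym , p ∘ ∼-sym) ne i≢j) fg)

    -- `f a` tells `g a` apart from every later `g b`, being adjacent to the former only.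
    InducedMatching-injective : ∀ {xs} → InducedMatching xs → AllPairs (λ a b → g a ≢ g b) xs
    InducedMatching-injective ([] , [])                   = []
    InducedMatching-injective {a ∷ _} (e ∷ es , ne ∷ nes) =
      All.map (λ (f≁g , _) eq → f≁g (subst (f a ∼_) eq e)) ne ∷ InducedMatching-injective (es , nes)

    -- Ramsey is applied in turn to `g a ∼ f b`, `f a ∼ g b` and `g a ∼ g b`. A long chain for the
    -- first yields a common neighbour from its head, one for the second from its last entry, since
    -- there the index of `g` comes later. Failing both, no cross edges remain and the matching is
    -- induced.
    sparsify : ∀ m n l {xs} → matchingBound m n l ≤ length xs → All (λ a → f a ∼ g a) xs →
      (∃[ a ] HasSublist m (All (λ b → g a ∼ f b)) xs)
      ⊎ HasSublist n (λ ys → InducedMatching ys × AllPairs (λ a b → g a ∼ g b) ys) xs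
      ⊎ HasSublist l (λ ys → InducedMatching ys × AllPairs (λ a b → ¬ g a ∼ g b) ys) xs
    sparsify m n l le e with ramsey (λ a b → g a ∼? f b) (suc m) _ le
    ... | inj₁ (a ∷ ys , ys⊆ , refl , h ∷ _) = inj₁ (a , ys , ⊆-trans (a ∷ʳ ⊆-refl) ys⊆ , refl , h)
    ... | inj₂ (ys , ys⊆ , eq , gf) with ramsey (λ a b → f a ∼? g b) (suc m) _ (ℕ.≤-reflexive (sym eq))
    ...   | inj₁ (zs , zs⊆ , eq′ , h) =
            let a , _ , ws , ws⊆ , eq″ , h′ = splitLast m eq′ h in
            inj₁ (a , ws , ⊆-trans ws⊆ (⊆-trans zs⊆ ys⊆) , eq″ , All.map ∼-sym h′)
    ...   | inj₂ (zs , zs⊆ , eq′ , fg)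
            with ramsey (λ a b → g a ∼? g b) n l (ℕ.≤-reflexive (sym eq′)) | ⊆-trans zs⊆ ys⊆
    ...     | inj₁ (ws , ws⊆ , eq″ , h) | zs⊆xs =
              inj₂ (inj₁ (ws , ⊆-trans ws⊆ zs⊆xs , eq″ , InducedMatching-resp-⊆ ws⊆
                (All-resp-⊆ zs⊆xs e , AllPairs.zip (fg , AllPairs-resp-⊆ zs⊆ gf)) , h))
    ...     | inj₂ (ws , ws⊆ , eq″ , h) | zs⊆xs =
              inj₂ (inj₂ (ws , ⊆-trans ws⊆ zs⊆xs , eq″ , InducedMatching-resp-⊆ ws⊆
                (All-resp-⊆ zs⊆xs e , AllPairs.zip (fg , AllPairs-resp-⊆ zs⊆ gf)) , h))

  InducedMatching-swap : ∀ (f g : A → Vertex) {xs} → InducedMatching f g xs → InducedMatching g f xs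
  InducedMatching-swap f g (e , ne) = All.map ∼-sym e , AllPairs.map (λ (p , q) → q , p) ne

  Independent : (A → Vertex) → Pred (List A) 0ℓ
  Independent f = AllPairs (λ a b → ¬ f a ∼ f b)

  Adjacent : (A → Vertex) → Pred (List A) 0ℓ
  Adjacent f = AllPairs (λ a b → f a ∼ f b)

  Independent⇒Nonadjacent : {f : A → Vertex} {xs : List A} → Independent f xs →
                            Nonadjacent (f ∘ lookup xs)
  Independent⇒Nonadjacent ind i j with i Fin.≟ j
  ... | yes refl = ∼-irrefl refl
  ... | no i≢j   = AllPairs-lookup (_∘ ∼-sym) ind i≢j

  Adjacent⇒Clique : {f : A → Vertex} {xs : List A} → Adjacent f xs → Clique (f ∘ lookup xs)
  Adjacent⇒Clique adj = AllPairs-lookup ∼-sym adj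

  -- `g` forms the clique and `f` the pendant vertices, hence the swap. They are disjoint because a
  -- vertex in both would give an edge inside `f`.
  matched-clique : ∀ (f g : A → Vertex) {xs} → Independent f xs → InducedMatching f g xs →
                   Adjacent g xs → K* (length xs) ≤ᴳ G
  matched-clique f g ind im adj =
    K*-≤ᴳ (Adjacent⇒Clique adj) non (Matching-swap m) λ i j eq → Matching-disjoint m non j i (sym eq)
    where
    m   = InducedMatching⇒Matching f g im
    non = Independent⇒Nonadjacent ind

  spider : ∀ (f g : A → Vertex) x {xs} → Independent f xs → Independent g xs →
           InducedMatching f g xs → All (λ a → x ∼ f a) xs → All (λ a → ¬ x ∼ g a) xs →
           All (λ a → x ≢ g a) xs → K₁* (length xs) ≤ᴳ G
  spider f g x indᶠ indᵍ im x∼f x≁g x≢g =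
    K₁*-≤ᴳ (Independent⇒Nonadjacent indᶠ) (Independent⇒Nonadjacent indᵍ)
           (InducedMatching⇒Matching f g im) (All-lookup x∼f) (All-lookup x≁g) (All-lookup x≢g)

  -- Common neighbours of many independent vertices in a ball

  module _ {n : ℕ} (K*-free : ¬ K* n ≤ᴳ G) (K₁*-free : ¬ K₁* n ≤ᴳ G) (r : Vertex) where

    -- Induction on the radius. If many of the vertices lie in the smaller ball, the hypothesis
    -- applies to them; otherwise many have parents there, and either one parent serves many of them
    -- or the hypothesis applies to the parents.
    common-neighbour : ∀ k m {f : A → Vertex} {xs} → neighbourBound n k m ≤ length xs →
      AllPairs (λ a b → f a ≢ f b) xs → Independent f xs → All (λ a → Within r k (f a)) xs →
      ∃[ y ] HasSublist m (All (λ a → y ∼ f a)) xs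
    common-neighbour zero m {xs = _ ∷ _ ∷ _} _ ((a≢b ∷ _) ∷ _) _ (ra ∷ rb ∷ _) =
      contradiction (trans (sym ra) rb) a≢b
    common-neighbour zero m {xs = _ ∷ []} (s≤s ()) _ _ _
    common-neighbour (suc k) m {f} le uniq ind within
      with pigeonhole (neighbourBound n k m) _ le within
    ... | inj₁ (ys , ys⊆ , eq , within′) =
          let y , zs , zs⊆ , eq′ , h = common-neighbour k m (ℕ.≤-reflexive (sym eq))
                (AllPairs-resp-⊆ ys⊆ uniq) (AllPairs-resp-⊆ ys⊆ ind) within′
          in y , zs , ⊆-trans zs⊆ ys⊆ , eq′ , h
    ... | inj₂ (ys , ys⊆ , eq , preds) with attach preds
    ...   | zs , refl =
          let y , ws , ws⊆ , eq′ , h = via-parents zs (ℕ.≤-reflexive (trans (sym eq) (length-map proj₁ zs)))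
                (AllPairs.map⁻ (AllPairs-resp-⊆ ys⊆ uniq)) (AllPairs.map⁻ (AllPairs-resp-⊆ ys⊆ ind))
          in y , map proj₁ ws , ⊆-trans (map⁺ proj₁ ws⊆) ys⊆ , trans (length-map proj₁ ws) eq′ , All.map⁺ h
      where
      child parent : Σ[ a ∈ _ ] ∃[ p ] Within r k p × p ∼ f a → Vertex
      child  = f ∘ proj₁
      parent = proj₁ ∘ proj₂

      via-parents : ∀ zs → matchingBound m n (neighbourBound n k (m + (n + 2))) ≤ length zs →
                    AllPairs (λ a b → child a ≢ child b) zs → Independent child zs →
                    ∃[ y ] HasSublist m (All (λ a → y ∼ child a)) zs
      via-parents zs le uniq ind
        with sparsify child parent m n _ le (All.universal (λ (_ , _ , _ , e) → ∼-sym e) zs)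
      ... | inj₁ (a , h) = parent a , h
      ... | inj₂ (inj₁ (ws , ws⊆ , refl , im , adj)) =
            ⊥-elim (K*-free (matched-clique child parent (AllPairs-resp-⊆ ws⊆ ind) im adj))
      ... | inj₂ (inj₂ (ws , ws⊆ , eq , im , ind′))
            -- The parents are distinct because they are matched to their children by an induced
            -- matching.
            with common-neighbour k (m + (n + 2)) {parent} (ℕ.≤-reflexive (sym eq))
                   (InducedMatching-injective child parent im) ind′
                   (All.universal (λ (_ , _ , w , _) → w) ws)
      ...   | x , us , us⊆ , eq′ , x∼
              with pigeonhole m (n + 2) (ℕ.≤-reflexive (sym eq′))
                              (All.universal (λ a → toSum (x ∼? child a)) us)
      ...     | inj₁ (vs , vs⊆ , eq″ , h) = x , vs , ⊆-trans vs⊆ (⊆-trans us⊆ ws⊆) , eq″ , h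
      ...     | inj₂ (vs , vs⊆ , eq″ , x≁)
                -- The children are distinct, so at most one of them is x; the others are the outer
                -- ends of a `K₁*` centred at x.
                with pigeonhole n 2 (ℕ.≤-reflexive (sym eq″))
                                (All.universal (λ a → swap (toSum (x ≟ child a))) vs)
                   | ⊆-trans vs⊆ us⊆
      ...       | inj₂ (a ∷ b ∷ [] , ab⊆ , _ , xa ∷ xb ∷ []) | vs⊆ws =
                  case AllPairs-resp-⊆ (⊆-trans ab⊆ (⊆-trans vs⊆ws ws⊆)) uniq of λ
                    { ((a≢b ∷ _) ∷ _) → contradiction (trans (sym xa) xb) a≢b }
      ...       | inj₁ (ts , ts⊆ , refl , x≢) | vs⊆ws =
                  ⊥-elim (K₁*-free (spider parent child x
                    (AllPairs-resp-⊆ ts⊆ws ind′) (AllPairs-resp-⊆ (⊆-trans ts⊆ws ws⊆) ind)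
                    (InducedMatching-swap child parent (InducedMatching-resp-⊆ child parent ts⊆ws im))
                    (All-resp-⊆ (⊆-trans ts⊆ vs⊆) x∼) (All-resp-⊆ ts⊆ x≁) x≢))
                  where
                  ts⊆ws = ⊆-trans ts⊆ vs⊆ws

  -- Disconnected neighbourhoods around a common neighbour x

  module _ (x : Vertex) where

    -- The last three clauses exclude walks of length 0, 1 and 2 from `x` to `w` inside N(v), a
    -- finite trace of their lying in different components.
    HasPrivateNeighbour : Pred Vertex 0ℓ
    HasPrivateNeighbour v =
      x ∼ v × ∃[ w ] v ∼ w × x ≢ w × ¬ x ∼ w × (∀ {u} → v ∼ u → x ∼ u → ¬ u ∼ w)

    private
      f g : ∃[ v ] HasPrivateNeighbour v → Vertex
      f = proj₁
      g (_ , _ , w , _) = w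

      x∼f : ∀ a → x ∼ f a
      x∼f (_ , e , _) = e

      f∼g : ∀ a → f a ∼ g a
      f∼g (_ , _ , _ , e , _) = e

      x≢g : ∀ a → x ≢ g a
      x≢g (_ , _ , _ , _ , ne , _) = ne

      x≁g : ∀ a → ¬ x ∼ g a
      x≁g (_ , _ , _ , _ , _ , ne , _) = ne

      -- `f b` is adjacent to `x` and lies in N(`f a`), so an edge to `g a` would join `x` to `g a`
      -- inside N(`f a`).
      f≁g : ∀ {a b} → f a ∼ f b → ¬ f b ∼ g a
      f≁g {_ , _ , _ , _ , _ , _ , far} {b} e = far e (x∼f b)

    private-neighbours : ∀ {xs} → All Disconnected xs → All (x ∼_) xs →
      ∃[ zs ] map (proj₁ {B = HasPrivateNeighbour}) zs ≡ xs
    private-neighbours dis x∼ =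
      attach (All.zipWith (λ (d , e) → e , unlinked-neighbour _ d (∼-sym e)) (dis , x∼))

    clique-case : ∀ n {xs} → ramseyBound n n ≤ length xs → All Disconnected xs →
                  All (x ∼_) xs → Adjacent id xs → (K* n ≤ᴳ G) ⊎ (CK n ≤ᴳ G)
    clique-case n le dis x∼ adj with private-neighbours dis x∼
    ... | zs , refl with AllPairs.map⁻ adj
    ...   | adj′ = conclude (ramsey (λ a b → g a ∼? g b) n n
                              (subst (ramseyBound n n ≤_) (length-map proj₁ zs) le))
      where
      im : InducedMatching f g zs
      -- In a clique `f≁g` applies to each pair in both orders, which gives both cross non-edges.
      im = All.universal f∼g zs ,
           AllPairs.map (λ {a} {b} e → f≁g {b} {a} (∼-sym e) , f≁g {a} {b} e ∘ ∼-sym) adj′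

      module _ {ys} (ys⊆ : ys ⊆ zs) where
        clique : Clique (f ∘ lookup ys)
        clique = Adjacent⇒Clique (AllPairs-resp-⊆ ys⊆ adj′)

        matching : Matching (f ∘ lookup ys) (g ∘ lookup ys)
        matching = InducedMatching⇒Matching f g (InducedMatching-resp-⊆ f g ys⊆ im)

        disjoint : Disjoint (f ∘ lookup ys) (g ∘ lookup ys)
        disjoint = separated (x∼f ∘ lookup ys) (x≁g ∘ lookup ys)

      conclude : HasSublist n (Adjacent g) zs ⊎ HasSublist n (Independent g) zs →
                 (K* n ≤ᴳ G) ⊎ (CK n ≤ᴳ G)
      conclude (inj₁ (ys , ys⊆ , refl , h)) =
        inj₂ (CK-≤ᴳ (clique ys⊆) (Adjacent⇒Clique h) (matching ys⊆) (disjoint ys⊆))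
      conclude (inj₂ (ys , ys⊆ , refl , h)) =
        inj₁ (K*-≤ᴳ (clique ys⊆) (Independent⇒Nonadjacent h) (matching ys⊆) (disjoint ys⊆))

    -- The cases of `sparsify` in order: a `g a` adjacent to many `f b` forms with `x` the small
    -- side of `K⟨ 2 , n ⟩`; a clique among the `g a` gives `K*`; independent `g a` give a `K₁*`
    -- centred at `x`.
    independent-case : ∀ n {xs} → matchingBound n n n ≤ length xs → All Disconnected xs →
                       All (x ∼_) xs → Unique xs → Independent id xs →
                       (K* n ≤ᴳ G) ⊎ (K₁* n ≤ᴳ G) ⊎ (K⟨ 2 , n ⟩ ≤ᴳ G)
    independent-case n le dis x∼ uniq ind with private-neighbours dis x∼
    ... | zs , refl with AllPairs.map⁻ uniq | AllPairs.map⁻ ind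
                       | sparsify f g n n n (subst (matchingBound n n n ≤_) (length-map proj₁ zs) le)
                                            (All.universal f∼g zs)
    ... | uniq′ | ind′ | inj₁ (a , ys , ys⊆ , refl , h) =
      inj₂ (inj₂ (K₂-≤ᴳ
        (λ {i} {j} eq → decidable-stable (i Fin.≟ j) λ i≢j →
          AllPairs-lookup (_∘ sym) (AllPairs-resp-⊆ ys⊆ uniq′) i≢j eq)
        (Independent⇒Nonadjacent (AllPairs-resp-⊆ ys⊆ ind′)) (x≢g a) (x≁g a)
        (x∼f ∘ lookup ys) (All-lookup h)))
    ... | _ | ind′ | inj₂ (inj₁ (ys , ys⊆ , refl , im , adj)) =
      inj₁ (matched-clique f g (AllPairs-resp-⊆ ys⊆ ind′) im adj)
    ... | _ | ind′ | inj₂ (inj₂ (ys , ys⊆ , refl , im , ind″)) =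
      inj₂ (inj₁ (spider f g x (AllPairs-resp-⊆ ys⊆ ind′) ind″ im
        (All.universal x∼f ys) (All.universal x≁g ys) (All.universal x≢g ys)))

  #disconnected-bounded : ∀ n → Connected G → ¬ K* n ≤ᴳ G → ¬ P n ≤ᴳ G → ¬ K₁* n ≤ᴳ G → ¬ K⟨ 2 , n ⟩ ≤ᴳ G →
            ¬ CK n ≤ᴳ G → #disconnectedNeighbourhoods G ≤ disconnectedBound n
  #disconnected-bounded n conn K*-free P-free K₁*-free K₂-free CK-free = ℕ.≮⇒≥ λ lt →
    impossible lt (All.all-filter disconnected? vertices)
               (Unique.filter⁺ disconnected? vertices-unique)
    where
    impossible : ∀ {xs} → disconnectedBound n < length xs → All Disconnected xs → Unique xs → ⊥
    -- Any vertex may be the root; the first of the list is taken.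
    impossible {r ∷ _} lt dis uniq with ramsey _∼?_ (suc (ramseyBound n n)) _ (ℕ.<⇒≤ lt)
    -- The first vertex of the clique is the common neighbour of the others.
    ... | inj₁ (x ∷ ys , ys⊆ , eq , x∼ ∷ adj) =
          [ K*-free , CK-free ]′ (clique-case x n (ℕ.≤-reflexive (sym (ℕ.suc-injective eq)))
            (All.tail (All-resp-⊆ ys⊆ dis)) x∼ adj)
    ... | inj₂ (ys , ys⊆ , eq , ind)
          with common-neighbour K*-free K₁*-free r n (matchingBound n n n) (ℕ.≤-reflexive (sym eq))
                 (AllPairs-resp-⊆ ys⊆ uniq) ind
                 (All.universal (P-free⇒within _ conn P-free) ys)
    ...   | x , zs , zs⊆ , eq′ , x∼ =
            [ K*-free , [ K₁*-free , K₂-free ]′ ]′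
              (independent-case x n (ℕ.≤-reflexive (sym eq′))
                (All-resp-⊆ (⊆-trans zs⊆ ys⊆) dis) x∼
                (AllPairs-resp-⊆ (⊆-trans zs⊆ ys⊆) uniq) (AllPairs-resp-⊆ zs⊆ ind))

-- Unboundedness on the forbidden graphs

hub-connected : ∀ G h → (∀ v → Graph.Linked G h v) → Connected G
hub-connected G h hub u v = reverse (Graph.∼-sym G) (hub u) ◅◅ hub v

other : ∀ {n} (i : Fin (2 + n)) → ∃[ j ] i ≢ j
other i = punchIn i zero , Fin.punchInᵢ≢i i zero ∘ sym

K*-connected : ∀ n → Connected (K* (suc n))
K*-connected n = hub-connected (K* (suc n)) (inj₁ zero)
  [ spoke , (λ i → spoke i ◅◅ refl ◅ ε) ]
  where
  spoke : ∀ i → Graph.Linked (K* (suc n)) (inj₁ zero) (inj₁ i)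
  spoke zero    = ε
  spoke (suc i) = (λ ()) ◅ ε

CK-connected : ∀ n → Connected (CK (suc n))
CK-connected n = hub-connected (CK (suc n)) (inj₁ zero)
  [ spoke , (λ i → spoke i ◅◅ refl ◅ ε) ]
  where
  spoke : ∀ i → Graph.Linked (CK (suc n)) (inj₁ zero) (inj₁ i)
  spoke zero    = ε
  spoke (suc i) = (λ ()) ◅ ε

K₁*-connected : ∀ n → Connected (K₁* n)
K₁*-connected n = hub-connected (K₁* n) (inj₁ (inj₁ zero)) λ
  { (inj₁ (inj₁ zero)) → ε
  ; (inj₁ (inj₂ i))    → _◅_ {j = inj₁ (inj₂ i)} _ ε
  ; (inj₂ i)           → _◅_ {j = inj₁ (inj₂ i)} _ (refl ◅ ε) }

K₂-connected : ∀ n → Connected K⟨ 2 , suc n ⟩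
K₂-connected n = hub-connected K⟨ 2 , suc n ⟩ (inj₁ zero) λ
  { (inj₁ zero)       → ε
  ; (inj₁ (suc zero)) → _◅_ {j = inj₂ zero} _ (_◅_ {j = inj₁ (suc zero)} _ ε)
  ; (inj₂ i)          → _◅_ {j = inj₂ i} _ ε }

P-connected : ∀ n → Connected (P (suc n))
P-connected n = hub-connected (P (suc n)) zero
  (<-weakInduction (Graph.Linked (P (suc n)) zero) ε
    (λ i path → path ◅◅ inj₁ (cong suc (Fin.toℕ-inject₁ i)) ◅ ε))

-- The pendant edge at a clique vertex is in no triangle; `2 + n` ensures a second clique vertex as
-- another neighbour.
K*-many : ∀ n → 2 + n ≤ #disconnectedNeighbourhoods (K* (2 + n))
K*-many n = #disconnected-≥ (K* (2 + n)) inj₁ (λ { refl → refl }) λ i →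
  triangle-free-edge (K* (2 + n)) (inj₁ i) {inj₂ i} {inj₁ (proj₁ (other i))}
    refl (proj₂ (other i)) (λ ()) (λ { {inj₁ j} i≢j j≡i → i≢j (sym j≡i) })

-- Here the matching edge at a vertex is in no triangle; counting one of the two copies is enough.
CK-many : ∀ n → 2 + n ≤ #disconnectedNeighbourhoods (CK (2 + n))
CK-many n = #disconnected-≥ (CK (2 + n)) inj₁ (λ { refl → refl }) λ i →
  triangle-free-edge (CK (2 + n)) (inj₁ i) {inj₂ i} {inj₁ (proj₁ (other i))}
    refl (proj₂ (other i)) (λ ())
    (λ { {inj₁ j} i≢j j≡i → i≢j (sym j≡i) ; {inj₂ j} i≡j i≢j → i≢j i≡j })

K₁*-many : ∀ n → n ≤ #disconnectedNeighbourhoods (K₁* n)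
K₁*-many n = #disconnected-≥ (K₁* n) (inj₁ ∘ inj₂) (λ { refl → refl }) λ i →
  triangle-free-edge (K₁* n) (inj₁ (inj₂ i)) {inj₂ i} {inj₁ (inj₁ zero)}
    refl _ (λ ()) (λ { {inj₁ (inj₁ _)} _ () ; {inj₁ (inj₂ _)} () })

K₂-many : ∀ n → n ≤ #disconnectedNeighbourhoods K⟨ 2 , n ⟩
K₂-many n = #disconnected-≥ K⟨ 2 , n ⟩ inj₂ (λ { refl → refl }) λ i →
  triangle-free-edge K⟨ 2 , n ⟩ (inj₂ i) {inj₁ zero} {inj₁ (suc zero)}
    _ _ (λ ()) (λ { {inj₁ _} _ () ; {inj₂ _} () })

-- The inner vertices of the path are counted, two fewer than all; `suc ∘ inject₁` enumerates them.
P-many : ∀ n → n ≤ #disconnectedNeighbourhoods (P (2 + n))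
P-many n = #disconnected-≥ (P (2 + n)) (suc ∘ inject₁)
  (Fin.inject₁-injective ∘ Fin.suc-injective) λ i →
  let j = inject₁ i
      toℕ-j = Fin.toℕ-inject₁ j in
  triangle-free-edge (P (2 + n)) (suc j) {inject₁ j} {suc (suc i)}
    (inj₂ (cong suc toℕ-j)) (inj₁ (cong (2 +_) (Fin.toℕ-inject₁ i)))
    (λ eq → ℕ.m≢1+n+m (toℕ i) (trans (sym (trans toℕ-j (Fin.toℕ-inject₁ i))) (cong toℕ eq)))
    (λ {b} e e′ → triangle-free e
      (subst (λ k → suc k ≡ toℕ b ⊎ suc (toℕ b) ≡ k) toℕ-j e′))
  where
  -- With the inner vertex at position k + 1, a neighbour b sits at k or k + 2, and neither is next
  -- to k.
  triangle-free : ∀ {k b} → 2 + k ≡ b ⊎ suc b ≡ suc k → ¬ (suc k ≡ b ⊎ suc b ≡ k)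
  triangle-free (inj₁ refl) (inj₁ ())
  triangle-free (inj₁ refl) (inj₂ ())
  triangle-free (inj₂ refl) (inj₁ ())
  triangle-free (inj₂ refl) (inj₂ ())

-- The two hubs are the added vertex and one vertex of the clique: they are nonadjacent and both
-- joined to the whole edgeless part.
K₂≤T : ∀ n → K⟨ 2 , suc n ⟩ ≤ᴳ T (suc n)
K₂≤T n = K₂-≤ᴳ (T (suc n)) {f = inj₁ ∘ inj₂} {inj₂ zero} {inj₁ (inj₁ zero)}
  (λ { refl → refl }) (λ _ _ ()) (λ ()) (λ ()) _ _

-- The equivalence for a family of graphs

theorem1p5 : ∀ {ℓ : Level} → ExcludedMiddle (ℓsuc 0ℓ ⊔ ℓ) →
    (𝓗 : Family ℓ) →
    (∃[ C ] (∀ (G : Graph) → Connected G → Free 𝓗 G → #disconnectedNeighbourhoods G ≤ C))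
    ⇔
    (∃[ n ] (1 ≤ n × 𝓗 ≤ᶠ sixGraphs n))
theorem1p5 em 𝓗 = mk⇔ necessary sufficient
  where
  necessary : (∃[ C ] (∀ (G : Graph) → Connected G → Free 𝓗 G → #disconnectedNeighbourhoods G ≤ C)) →
              ∃[ n ] (1 ≤ n × 𝓗 ≤ᶠ sixGraphs n)
  -- A path on 3 + C vertices has 1 + C inner ones, just enough to exceed C.
  necessary (C , bound) = 3 + C , s≤s z≤n , below
    where
    not-free : ∀ G → Connected G → C < #disconnectedNeighbourhoods G → ∃[ H ] 𝓗 H × H ≤ᴳ G
    -- `Free` is a negation, so it takes classical logic to produce a member of `𝓗`.
    not-free G conn lt = em⇒dne em λ free → ℕ.<⇒≱ lt (bound G conn free)

    3+C≤⇒ : ∀ {k} → 3 + C ≤ k → C < k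
    3+C≤⇒ = ℕ.≤-trans (ℕ.m≤n+m (suc C) 2)

    below : 𝓗 ≤ᶠ sixGraphs (3 + C)
    below _ (here refl) = not-free (K* (3 + C)) (K*-connected _) (3+C≤⇒ (K*-many (suc C)))
    below _ (there (here refl)) = not-free (P (3 + C)) (P-connected _) (P-many (suc C))
    below _ (there (there (here refl))) = not-free (K₁* (3 + C)) (K₁*-connected _) (3+C≤⇒ (K₁*-many _))
    below _ (there (there (there (here refl)))) = not-free K⟨ 2 , 3 + C ⟩ (K₂-connected _) (3+C≤⇒ (K₂-many _))
    below _ (there (there (there (there (here refl))))) =
      not-free (CK (3 + C)) (CK-connected _) (3+C≤⇒ (CK-many (suc C)))
    below _ (there (there (there (there (there (here refl)))))) =
      let H , H∈ , H≤ = not-free K⟨ 2 , 3 + C ⟩ (K₂-connected _) (3+C≤⇒ (K₂-many _)) in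
      H , H∈ , ≤ᴳ-trans {H} {K⟨ 2 , 3 + C ⟩} {T (3 + C)} H≤ (K₂≤T _)

  sufficient : ∃[ n ] (1 ≤ n × 𝓗 ≤ᶠ sixGraphs n) →
               ∃[ C ] (∀ (G : Graph) → Connected G → Free 𝓗 G → #disconnectedNeighbourhoods G ≤ C)
  sufficient (n , _ , below) = disconnectedBound n , λ G conn free →
    let avoids : ∀ H → sixGraphs n H → ¬ H ≤ᴳ G
        avoids H H∈ H≤G = let H′ , H′∈ , H′≤H = below H H∈ in
          free (H′ , H′∈ , ≤ᴳ-trans {H′} {H} {G} H′≤H H≤G)
    in #disconnected-bounded G n conn
         (avoids _ (here refl)) (avoids _ (there (here refl)))
         (avoids _ (there (there (here refl)))) (avoids _ (there (there (there (here refl)))))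
         (avoids _ (there (there (there (there (here refl))))))
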